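{- Let $A$ be a set of actions and let $\mathcal S$ be an $\mathcal{EL}$-based proof system over $StExp(A)$ with $\mathsf{ACI}\subseteq\mathcal S\precsim\mathsf{Mil}$. Then for all $e_1,e_2\in StExp(A)$: if there is an LLEE-witnessed coinductive proof over $\mathcal S$ of $e_1=e_2$, then $e_1=_{\mathsf{Mil}}e_2$.
   Context: **Star expressions and equational systems.** Star expressions over $A$, forming the set $StExp(A)$, are given by $e ::= 0 \mid 1 \mid a \mid (e_1+e_2)\mid (e_1\cdot e_2)\mid (e^*)$ with $a\in A$. $\equiv$ is syntactic equality. $Eq(A)$ is the set of formal equations $e=f$ with $e,f\in StExp(A)$. Immediate termination $e{\downarrow}$ is defined inductively: $1{\downarrow}$; $(e_1+e_2){\downarrow}$ if $e_1{\downarrow}$ or $e_2{\downarrow}$; $(e_1\cdot e_2){\downarrow}$ if $e_1{\downarrow}$ and $e_2{\downarrow}$; $(e^*){\downarrow}$ always. Finite sums $\sum_{i=1}^n e_i$ denote $0$ if $n=0$, $e_1$ if $n=1$, and $(\sum_{i=1}^{n-1}e_i)+e_n$ if $n>1$. An $\mathcal{EL}$-based system over $StExp(A)$ is a proof system whose formulas are the equations in $Eq(A)$ and whose rules include those of equational logic (reflexivity, symmetry, transitivity, closure under one-hole star expression contexts); it may have further axioms and rules. $e=_{\mathcal S}f$ means that $e=f$ is derivable in $\mathcal S$ without assumptions. $\mathsf{ACI}$ is the $\mathcal{EL}$-based system whose axioms are associativity, commutativity and idempotency of $+$. $\mathcal S_1\subseteq\mathcal S_2$ means that every axiom and every rule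 of $\mathcal S_1$ is one of $\mathcal S_2$; $\mathcal S_1\precsim\mathcal S_2$ means that every equation derivable in $\mathcal S_1$ (without assumptions) is derivable in $\mathcal S_2$. $\mathsf{Mil}^-$ is the $\mathcal{EL}$-based system with only the rules of equational logic and the axiom schemes: $(e+f)+g=e+(f+g)$; $e+0=e$; $e+f=f+e$; $e+e=e$; $(e\cdot f)\cdot g=e\cdot(f\cdot g)$; $(e+f)\cdot g=e\cdot g+f\cdot g$; $1\cdot e=e$; $e\cdot 1=e$; $0\cdot e=0$; $e^*=1+e\cdot e^*$; $e^*=(1+e)^*$. Milner's system $\mathsf{Mil}$ is $\mathsf{Mil}^-$ plus the rule $\mathrm{RSP}^*$: from $e=f\cdot e+g$ infer $e=f^*\cdot g$, provided that $f{\downarrow}$ does not hold. **1-charts and LLEE.** A 1-chart is a tuple $\underline{C}=\langle V,A,1,v_s,\to,{\downarrow}\rangle$ with $V$ a finite set of vertices, $1\notin A$ the empty-step label, $v_s\in V$ the start vertex, ${\to}\subseteq V\times(A\cup\{1\})\times V$ a (finite) labeled transition relation, and ${\downarrow}\subseteq V$ the set of vertices with immediate termination. Transitions labeled in $A$ are proper; those labeled $1$ are 1-transitions. It is weakly guarded if it has no cycle of 1-transitions. A loop 1-chart is a 1-chart such that (L1) there is an infinite path from its start vertex, (L2) every infinite path from the start vertex returns to it after a positive number of transitions, (L3) only the start vertex may have immediate termination. For a vertex $v$ of $\underline C$ and a nonempty set $U$ of transitions from $v$, consider the sub-1-chart with start vertex $v$ consisting of all vertices and transitions on paths that start with a transition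 in $U$ and continue until $v$ is reached again (termination inherited from $\underline C$). If it is a loop 1-chart it is called a loop sub-1-chart of $\underline C$, with loop-entry transitions $U$; its remaining transitions are its loop-body transitions. Eliminating it from $\underline C$ means removing the transitions in $U$ and then all vertices and transitions that become unreachable from the start vertex. $\underline C$ is an LLEE-1-chart if there is a finite sequence $\underline C=\underline C_0,\dots,\underline C_n$ where $\underline C_i$ results from $\underline C_{i-1}$ by eliminating a loop sub-1-chart $L_i$ of $\underline{C}_{i-1}$ with loop-entry transitions $U_i$, $\underline C_n$ has no infinite path, and for $i<j$ no transition in $U_j$ is a loop-body transition of $L_i$ (layeredness). **Coinductive proofs.** Let $\mathcal S$ be an $\mathcal{EL}$-based system with $\mathsf{ACI}\subseteq\mathcal S$. A function $s:V\to StExp(A)$ is an $\mathcal S$-provable solution of $\underline C$ if for every $v\in V$, with $\{v\xrightarrow{\underline a_i}v_i\mid 1\le i\le n\}$ a list of all transitions from $v$, it holds that $s(v)=_{\mathcal S}\tau(v)+\sum_{i=1}^n\underline a_i\cdot s(v_i)$, where $\tau(v)\equiv 1$ if $v\in{\downarrow}$ and $\tau(v)\equiv 0$ otherwise (the label $1$ being read as the star expression $1$). A coinductive proof over $\mathcal S$ of $e_1=e_2$ is a pair $\langle\underline C,L\rangle$ with $\underline C$ a weakly guarded 1-chart and $L:V\to Eq(A)$, $L(v)=(L_1(v)=L_2(v))$, such that $L_1$ and $L_2$ are $\mathcal S$-provable solutions of $\underline C$, and $e_1\equiv L_1(v_s)$, $e_2\equiv L_2(v_s)$. It is LLEE-witnessed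 if $\underline C$ is an LLEE-1-chart. -}

module Defs where

open import Data.Bool.Base using (if_then_else_)
open import Data.Empty using (⊥)
open import Data.Fin.Base as Fin using (Fin; zero; suc; inject₁; fromℕ)
import Data.Fin.Properties as Fin
open import Data.Fin.Subset as Subset using (Subset; _∈_; _∉_; Nonempty)
import Data.Fin.Subset.Properties as Subset
open import Data.List.Base using (List; []; _∷_; map; filter; foldl; allFin)
open import Data.List.Relation.Unary.All using (All)
open import Data.Maybe.Base using (Maybe; just; nothing)
open import Data.Nat.Base using (ℕ; zero; suc)
open import Data.Product.Base using (∃-syntax; _×_; _,_)
open import Data.Sum.Base using (_⊎_)
open import Data.Unit.Base using (⊤; tt)
open import Data.Vec.Base using (lookup)
open import Function.Bundles using (_⇔_)
open import Function.Definitions using (Injective)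
open import Relation.Binary.Construct.Closure.ReflexiveTransitive using (Star)
open import Relation.Binary.Construct.Closure.Transitive using (TransClosure)
open import Relation.Binary.PropositionalEquality.Core using (_≡_; _≢_)
open import Relation.Nullary.Negation.Core using (¬_)

------------------------------------------------------------------------
-- Star expressions

infixl 6 _+_
infixl 7 _·_
infix  8 _*
infix  4 _↓ _≐_

data StExp (A : Set) : Set where
  𝟎 𝟏     : StExp A
  act     : A → StExp A
  _+_ _·_ : StExp A → StExp A → StExp A
  _*      : StExp A → StExp A

data _↓ {A : Set} : StExp A → Set where
  𝟏↓  : 𝟏 ↓
  +↓ˡ : ∀ {e f} → e ↓ → (e + f) ↓
  +↓ʳ : ∀ {e f} → f ↓ → (e + f) ↓
  ·↓  : ∀ {e f} → e ↓ → f ↓ → (e · f) ↓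
  *↓  : ∀ {e} → (e *) ↓

-- Sums are nested to the left and contain no redundant summand 𝟎.
sum : {A : Set} → List (StExp A) → StExp A
sum []       = 𝟎
sum (e ∷ es) = foldl _+_ e es

record Eq (A : Set) : Set where
  constructor _≐_
  field
    lhs rhs : StExp A

open Eq public

data Context (A : Set) : Set where
  □       : Context A
  _+ˡ_    : Context A → StExp A → Context A
  _+ʳ_    : StExp A → Context A → Context A
  _·ˡ_    : Context A → StExp A → Context A
  _·ʳ_    : StExp A → Context A → Context A
  _*ᶜ     : Context A → Context A

_[_] : {A : Set} → Context A → StExp A → StExp A
□        [ e ] = e
(C +ˡ f) [ e ] = (C [ e ]) + f
(f +ʳ C) [ e ] = f + (C [ e ])
(C ·ˡ f) [ e ] = (C [ e ]) · f
(f ·ʳ C) [ e ] = f · (C [ e ])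
(C *ᶜ)   [ e ] = (C [ e ]) *

------------------------------------------------------------------------
-- EL-based proof systems

-- A system is given by what it has in addition to the rules of
-- equational logic: a set of axioms, and a family of rules, each of which
-- is the set of its instances (list of premises, conclusion).  The rules
-- of equational logic, common to all systems, are built into _⊢_.
record ELSystem (A : Set) : Set₁ where
  field
    Axiom    : Eq A → Set
    Rule     : Set
    Instance : Rule → List (Eq A) → Eq A → Set

open ELSystem public

infix 3 _⊢_

data _⊢_ {A : Set} (S : ELSystem A) : Eq A → Set where
  axiom      : ∀ {q} → Axiom S q → S ⊢ q
  rule       : ∀ {r ps q} → Instance S r ps q → All (S ⊢_) ps → S ⊢ q
  reflexive  : ∀ {e} → S ⊢ e ≐ e
  symmetric  : ∀ {e f} → S ⊢ e ≐ f → S ⊢ f ≐ e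
  transitive : ∀ {e f g} → S ⊢ e ≐ f → S ⊢ f ≐ g → S ⊢ e ≐ g
  context    : ∀ {e f} (C : Context A) →
               S ⊢ e ≐ f → S ⊢ (C [ e ]) ≐ (C [ f ])

infix 4 _⊆_ _≾_

_⊆_ : {A : Set} → ELSystem A → ELSystem A → Set
S₁ ⊆ S₂ =
  (∀ q → Axiom S₁ q → Axiom S₂ q) ×
  (∀ r₁ → ∃[ r₂ ] (∀ ps q → Instance S₁ r₁ ps q ⇔ Instance S₂ r₂ ps q))

_≾_ : {A : Set} → ELSystem A → ELSystem A → Set
S₁ ≾ S₂ = ∀ q → S₁ ⊢ q → S₂ ⊢ q

data ACIAxiom {A : Set} : Eq A → Set where
  +-assoc : ∀ e f g → ACIAxiom ((e + f) + g ≐ e + (f + g))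
  +-comm  : ∀ e f   → ACIAxiom (e + f ≐ f + e)
  +-idem  : ∀ e     → ACIAxiom (e + e ≐ e)

ACI : {A : Set} → ELSystem A
ACI = record { Axiom = ACIAxiom ; Rule = ⊥ ; Instance = λ () }

data MilAxiom {A : Set} : Eq A → Set where
  +-assoc     : ∀ e f g → MilAxiom ((e + f) + g ≐ e + (f + g))
  +-identityʳ : ∀ e     → MilAxiom (e + 𝟎 ≐ e)
  +-comm      : ∀ e f   → MilAxiom (e + f ≐ f + e)
  +-idem      : ∀ e     → MilAxiom (e + e ≐ e)
  ·-assoc     : ∀ e f g → MilAxiom ((e · f) · g ≐ e · (f · g))
  ·-distribʳ  : ∀ e f g → MilAxiom ((e + f) · g ≐ e · g + f · g)
  ·-identityˡ : ∀ e     → MilAxiom (𝟏 · e ≐ e)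
  ·-identityʳ : ∀ e     → MilAxiom (e · 𝟏 ≐ e)
  ·-zeroˡ     : ∀ e     → MilAxiom (𝟎 · e ≐ 𝟎)
  *-unfold    : ∀ e     → MilAxiom (e * ≐ 𝟏 + e · e *)
  *-𝟏+        : ∀ e     → MilAxiom (e * ≐ (𝟏 + e) *)

Mil⁻ : {A : Set} → ELSystem A
Mil⁻ = record { Axiom = MilAxiom ; Rule = ⊥ ; Instance = λ () }

data RSP* {A : Set} : List (Eq A) → Eq A → Set where
  rsp* : ∀ e f g → ¬ (f ↓) → RSP* ((e ≐ f · e + g) ∷ []) (e ≐ f * · g)

Mil : {A : Set} → ELSystem A
Mil = record { Axiom = Axiom Mil⁻ ; Rule = ⊤ ; Instance = λ _ → RSP* }

------------------------------------------------------------------------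
-- 1-charts

-- Transition labels A ∪ {1}: nothing is the empty-step label 1.
Label : Set → Set
Label = Maybe

⌜_⌝ : {A : Set} → Label A → StExp A
⌜ just a ⌝  = act a
⌜ nothing ⌝ = 𝟏

-- The vertices are Fin ∣V∣.  The transition relation, a finite set of
-- triples, is given by an enumeration without repetitions, so that sets of
-- transitions are subsets of Fin ∣→∣.
record 1-Chart (A : Set) : Set where
  field
    ∣V∣ ∣→∣     : ℕ
    start       : Fin ∣V∣
    transition  : Fin ∣→∣ → Fin ∣V∣ × Label A × Fin ∣V∣
    distinct    : Injective _≡_ _≡_ transition
    terminating : Subset ∣V∣

  V : Set
  V = Fin ∣V∣

  Tr : Set
  Tr = Fin ∣→∣

  src : Tr → V
  src t = let v , _ , _ = transition t in v

  label : Tr → Label A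
  label t = let _ , l , _ = transition t in l

  tgt : Tr → V
  tgt t = let _ , _ , w = transition t in w

  transitionsFrom : V → List Tr
  transitionsFrom v = filter (λ t → src t Fin.≟ v) (allFin ∣→∣)

  τ : V → StExp A
  τ v = if lookup terminating v then 𝟏 else 𝟎

module _ {A : Set} (C : 1-Chart A) where
  open 1-Chart C

  1-Step : V → V → Set
  1-Step v w = ∃[ t ] (src t ≡ v × label t ≡ nothing × tgt t ≡ w)

  WeaklyGuarded : Set
  WeaklyGuarded = ∀ v → ¬ TransClosure 1-Step v v

  -- The 1-charts formed from vertices and transitions of C, with
  -- termination inherited from C.  Loop sub-1-charts of C, and the results
  -- of eliminating them, are all of this form.
  record Sub : Set where
    field
      root        : V
      vertices    : Subset ∣V∣
      transitions : Subset ∣→∣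
      root∈       : root ∈ vertices
      src∈        : ∀ {t} → t ∈ transitions → src t ∈ vertices
      tgt∈        : ∀ {t} → t ∈ transitions → tgt t ∈ vertices

  open Sub

  whole : Sub
  whole = record
    { root        = start
    ; vertices    = Subset.⊤
    ; transitions = Subset.⊤
    ; root∈       = Subset.∈⊤
    ; src∈        = λ _ → Subset.∈⊤
    ; tgt∈        = λ _ → Subset.∈⊤
    }

  record InfinitePath (D : Sub) (v : V) : Set where
    field
      step   : ℕ → Tr
      step∈  : ∀ i → step i ∈ transitions D
      begins : src (step 0) ≡ v
      linked : ∀ i → tgt (step i) ≡ src (step (suc i))

  open InfinitePath

  record IsLoop (D : Sub) : Set where
    field
      L1 : InfinitePath D (root D)
      L2 : (π : InfinitePath D (root D)) → ∃[ i ] tgt (step π i) ≡ root D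
      L3 : ∀ w → w ∈ vertices D → w ∈ terminating → w ≡ root D

  -- t lies on a path in D that starts with a transition in U and stops as
  -- soon as it reaches v (a path that never reaches v is followed
  -- indefinitely).
  data Generated (D : Sub) (v : V) (U : Subset ∣→∣) : Tr → Set where
    entry    : ∀ {t} → t ∈ U → Generated D v U t
    continue : ∀ {t t′} → Generated D v U t → tgt t ≢ v →
               t′ ∈ transitions D → src t′ ≡ tgt t → Generated D v U t′

  -- L is a loop sub-1-chart of D with loop-entry transitions U.
  record IsLoopSub (D : Sub) (U : Subset ∣→∣) (L : Sub) : Set where
    field
      vertex           : root L ∈ vertices D
      nonempty         : Nonempty U
      entries          : ∀ t → t ∈ U → t ∈ transitions D × src t ≡ root L
      transitions-spec : ∀ t → t ∈ transitions L ⇔ Generated D (root L) U t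
      vertices-spec    : ∀ w → w ∈ vertices L ⇔
        (w ≡ root L ⊎ ∃[ t ] (t ∈ transitions L × (src t ≡ w ⊎ tgt t ≡ w)))
      isLoop           : IsLoop L

  StepWithout : Sub → Subset ∣→∣ → V → V → Set
  StepWithout D U v w =
    ∃[ t ] (t ∈ transitions D × t ∉ U × src t ≡ v × tgt t ≡ w)

  -- D′ results from D by eliminating a loop sub-1-chart with loop-entry
  -- transitions U.
  record Eliminates (D : Sub) (U : Subset ∣→∣) (D′ : Sub) : Set where
    Reachable : V → Set
    Reachable = Star (StepWithout D U) (root D)

    field
      root-spec        : root D′ ≡ root D
      vertices-spec    : ∀ w → w ∈ vertices D′ ⇔ Reachable w
      transitions-spec : ∀ t → t ∈ transitions D′ ⇔
        (t ∈ transitions D × t ∉ U × Reachable (src t))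

  -- For i : Fin k, charts (inject₁ i) and charts (suc i) are the 1-charts
  -- before and after elimination of loops i.
  record LLEE : Set where
    field
      k          : ℕ
      charts     : Fin (suc k) → Sub
      loops      : Fin k → Sub
      entries    : Fin k → Subset ∣→∣
      initial    : charts zero ≡ whole
      loopSub    : ∀ i → IsLoopSub (charts (inject₁ i)) (entries i) (loops i)
      eliminates : ∀ i → Eliminates (charts (inject₁ i)) (entries i) (charts (suc i))
      final      : ∀ v → ¬ InfinitePath (charts (fromℕ k)) v
      layered    : ∀ i j → i Fin.< j → ∀ t → t ∈ entries j →
                   ¬ (t ∈ transitions (loops i) × t ∉ entries i)

------------------------------------------------------------------------
-- Provable solutions and coinductive proofs

-- The sum follows the order of the enumeration of transitions; if ACI ⊆ S,
-- every other order gives an equivalent condition.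
IsSolution : {A : Set} → ELSystem A → (C : 1-Chart A) →
             (1-Chart.V C → StExp A) → Set
IsSolution S C s = ∀ v →
  S ⊢ s v ≐ τ v + sum (map (λ t → ⌜ label t ⌝ · s (tgt t)) (transitionsFrom v))
  where open 1-Chart C

record CoinductiveProof {A : Set} (S : ELSystem A) (e₁ e₂ : StExp A) : Set where
  field
    chart         : 1-Chart A
    weaklyGuarded : WeaklyGuarded chart

  open 1-Chart chart using (V; start)

  field
    L         : V → Eq A
    solution₁ : IsSolution S chart (λ v → lhs (L v))
    solution₂ : IsSolution S chart (λ v → rhs (L v))
    start₁    : e₁ ≡ lhs (L start)
    start₂    : e₂ ≡ rhs (L start)

LLEEWitnessed : {A : Set} {S : ELSystem A} {e₁ e₂ : StExp A} →
                CoinductiveProof S e₁ e₂ → Set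
LLEEWitnessed P = LLEE (CoinductiveProof.chart P)

{-# OPTIONS --safe #-}

-- Loop elimination is mirrored by equation solving.  Throughout the
-- elimination every remaining vertex w carries an expression E with ¬ E ↓
-- such that each solution s satisfies
--
--   s w = E · s w + (τ w + ∑ a · s w′),  the sum over remaining transitions,
--
-- where E accounts for the loop-entry transitions eliminated at w.  When a
-- loop at v is eliminated, its body is acyclic apart from returns to v, so
-- RSP* yields s w = T · s v along the body, with T independent of s.  The
-- loop-entry summands a · s w of s v can thus be absorbed as (a · T) · s v.
-- The new coefficient does not terminate immediately because T ↓ only if
-- there is a path of 1-transitions from w back to v, and C is weakly
-- guarded.  The final 1-chart is acyclic, and RSP* determines s there.
module Submission where

open import Defs
open import Algebra.Bundles using (CommutativeMonoid)
import Algebra.Properties.CommutativeMonoid.Sum as CommutativeMonoidSum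
import Algebra.Properties.CommutativeSemigroup as CommutativeSemigroupProperties
open import Data.Bool.Base using (true; false)
open import Data.Empty using (⊥-elim)
open import Data.Fin.Base using (Fin; zero; suc; fromℕ)
open import Data.Fin.Induction using (spo-noetherian; <-weakInduction)
open import Data.Fin.Properties using (_≟_)
open import Data.Fin.Subset using (Subset; _∈_; _∉_)
open import Data.Fin.Subset.Properties using (_∈?_; ∈⊤)
open import Data.List.Base using ([]; _∷_; foldl; foldr; filter; map; tabulate)
open import Data.List.Relation.Unary.All using ([]; _∷_)
open import Data.Maybe.Base using (nothing)
open import Data.Nat.Base using (ℕ; zero; suc)
open import Data.Product.Base using (∃-syntax; _×_; _,_; proj₁; proj₂)
open import Data.Sum.Base using (_⊎_; inj₁; inj₂; [_,_]′)
open import Data.Unit.Base using (tt)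
open import Data.Vec.Base using (lookup)
open import Data.Vec.Properties using (lookup⇒[]=)
open import Function.Base using (_∘_; id; flip)
open import Function.Bundles using (_⇔_; mk⇔; Equivalence)
open import Induction.WellFounded using (Acc; acc; WellFounded; module Subrelation)
open import Level using (0ℓ)
open import Relation.Binary.Core using (Rel)
open import Relation.Binary.Construct.Closure.ReflexiveTransitive using (Star; ε; _◅_; _◅◅_)
open import Relation.Binary.Construct.Closure.Transitive using (TransClosure; [_]; _∷_; _++_)
open import Relation.Binary.PropositionalEquality
  using (_≡_; _≢_; refl; sym; trans; cong; subst; isEquivalence; resp₂)
import Relation.Binary.Reasoning.Setoid as SetoidReasoning
open import Relation.Nullary.Decidable using (Dec; yes; no; _×-dec_)
open import Relation.Nullary.Negation using (¬_; contradiction)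
open import Relation.Unary using (Pred; Decidable)

open Equivalence using (to; from)
open Defs.Sub
open InfinitePath

-- Acyclic relations on finite sets

module _ {X : Set} {R : Rel X 0ℓ} where

  ◅⇒⁺ : ∀ {x y z} → R x y → Star R y z → TransClosure R x z
  ◅⇒⁺ xRy ε            = [ xRy ]
  ◅⇒⁺ xRy (yRz ◅ zR*w) = xRy ∷ ◅⇒⁺ yRz zR*w

  *-++ : ∀ {x y z} → Star R x y → TransClosure R y z → TransClosure R x z
  *-++ ε            yR⁺z = yR⁺z
  *-++ (xRw ◅ wR*y) yR⁺z = xRw ∷ *-++ wR*y yR⁺z

  -- Each state stores a nonempty path from the current point to `c`. A step follows that path, and
  -- when it arrives at `c` the stored cycle is taken up again, so the walk never ends.
  lasso : ∀ {x c} → TransClosure R x c → TransClosure R c c →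
          ∃[ f ] (f 0 ≡ x × (∀ i → R (f i) (f (suc i))))
  lasso {x} {c} xR⁺c cR⁺c =
    proj₁ ∘ state , refl , λ i → proj₁ (proj₂ (advance (state i)))
    where
    State : Set
    State = ∃[ y ] TransClosure R y c

    advance : (p : State) → ∃[ z ] (R (proj₁ p) z × TransClosure R z c)
    advance (y , [ yRc ])     = c , yRc , cR⁺c
    advance (y , yRz ∷ zR⁺c) = _ , yRz , zR⁺c

    state : ℕ → State
    state zero    = x , xR⁺c
    state (suc i) = let z , _ , zR⁺c = advance (state i) in z , zR⁺c

-- Acyclicity makes the transitive closure a strict partial order, and on a finite set these are
-- Noetherian. With `flip`, recursion runs from a point to its `R`-successors.
acyclic⇒noetherian : ∀ {n} {R : Rel (Fin n) 0ℓ} →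
                     (∀ x → ¬ TransClosure R x x) → WellFounded (flip R)
acyclic⇒noetherian {R = R} acyclic =
  Subrelation.wellFounded {_<₁_ = flip R} {_<₂_ = flip (TransClosure R)} [_] (spo-noetherian (record
    { isEquivalence = isEquivalence
    ; irrefl        = λ { refl → acyclic _ }
    ; trans         = _++_
    ; <-resp-≈      = resp₂ _
    }))

-- Derivability in Mil

module _ {A : Set} where

  infix 4 _≈_
  _≈_ : Rel (StExp A) 0ℓ
  e ≈ f = Mil ⊢ e ≐ f

  +-cong : ∀ {e e′ f f′} → e ≈ e′ → f ≈ f′ → e + f ≈ e′ + f′
  +-cong {e′ = e′} {f = f} p q =
    transitive (context (□ +ˡ f) p) (context (e′ +ʳ □) q)

  ·-cong : ∀ {e e′ f f′} → e ≈ e′ → f ≈ f′ → e · f ≈ e′ · f′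
  ·-cong {e′ = e′} {f = f} p q =
    transitive (context (□ ·ˡ f) p) (context (e′ ·ʳ □) q)

  +-𝟎-commutativeMonoid : CommutativeMonoid 0ℓ 0ℓ
  +-𝟎-commutativeMonoid = record
    { Carrier = StExp A ; _≈_ = _≈_ ; _∙_ = _+_ ; ε = 𝟎
    ; isCommutativeMonoid = record
      { isMonoid = record
        { isSemigroup = record
          { isMagma = record
            { isEquivalence = record
              { refl = reflexive ; sym = symmetric ; trans = transitive }
            ; ∙-cong = +-cong
            }
          ; assoc = λ e f g → axiom (+-assoc e f g)
          }
        ; identity =
            (λ e → transitive (axiom (+-comm 𝟎 e)) (axiom (+-identityʳ e))) ,
            (λ e → axiom (+-identityʳ e))
        }
      ; comm = λ e f → axiom (+-comm e f)
      }
    }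

  open CommutativeMonoid +-𝟎-commutativeMonoid
    using (setoid; commutativeSemigroup) renaming (identityˡ to +-identityˡ)
  open CommutativeMonoidSum +-𝟎-commutativeMonoid
    using (sum-cong-≋; ∑-distrib-+) renaming (sum to ∑)
  open CommutativeSemigroupProperties commutativeSemigroup using (x∙yz≈y∙xz)
  open SetoidReasoning setoid hiding (start)

  rsp : ∀ {e f g} → ¬ f ↓ → e ≈ f · e + g → e ≈ f * · g
  rsp ¬f↓ p = rule {r = tt} (rsp* _ _ _ ¬f↓) (p ∷ [])

  -- Finite sums with guarded summands

  ∑-· : ∀ {n} (f : Fin n → StExp A) e → ∑ f · e ≈ ∑ (λ i → f i · e)
  ∑-· {zero}  f e = axiom (·-zeroˡ e)
  ∑-· {suc n} f e =
    transitive (axiom (·-distribʳ _ _ e)) (+-cong reflexive (∑-· (f ∘ suc) e))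

  ∑↓ : ∀ {n} (f : Fin n → StExp A) → ∑ f ↓ → ∃[ i ] f i ↓
  ∑↓ {suc n} f (+↓ˡ f₀↓) = zero , f₀↓
  ∑↓ {suc n} f (+↓ʳ ∑↓′) = let i , fᵢ↓ = ∑↓ (f ∘ suc) ∑↓′ in suc i , fᵢ↓

  ⌜⌝↓ : (l : Label A) → ⌜ l ⌝ ↓ → l ≡ nothing
  ⌜⌝↓ nothing _ = refl

  -- The guarded expression may depend on the proof of `P`: coefficients are computed only for
  -- transitions known to lie in a given set.
  when : {P : Set} → Dec P → (P → StExp A) → StExp A
  when (yes p) f = f p
  when (no  _) f = 𝟎

  module _ {P : Set} where

    when↓ : (P? : Dec P) {f : P → StExp A} → when P? f ↓ → ∃[ p ] f p ↓
    when↓ (yes p) fp↓ = p , fp↓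

    when-cong : (P? : Dec P) {f g : P → StExp A} →
                (∀ p → f p ≈ g p) → when P? f ≈ when P? g
    when-cong (yes p) f≈g = f≈g p
    when-cong (no  _) f≈g = reflexive

    when-· : (P? : Dec P) (f : P → StExp A) (e : StExp A) →
             when P? f · e ≈ when P? (λ p → f p · e)
    when-· (yes p) f e = reflexive
    when-· (no  _) f e = axiom (·-zeroˡ e)

    when-⇔ : ∀ {Q : Set} (P? : Dec P) (Q? : Dec Q) {e} → P ⇔ Q →
             when P? (λ _ → e) ≈ when Q? (λ _ → e)
    when-⇔ (yes p) (yes q) P⇔Q = reflexive
    when-⇔ (yes p) (no ¬q) P⇔Q = contradiction (to P⇔Q p) ¬q
    when-⇔ (no ¬p) (yes q) P⇔Q = contradiction (from P⇔Q q) ¬p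
    when-⇔ (no ¬p) (no ¬q) P⇔Q = reflexive

    -- Idempotency of `+` covers the case in which both disjuncts hold.
    when-⊎ : ∀ {Q R : Set} (P? : Dec P) (Q? : Dec Q) (R? : Dec R) {e} →
             P ⇔ (Q ⊎ R) →
             when P? (λ _ → e) ≈ when Q? (λ _ → e) + when R? (λ _ → e)
    when-⊎ (yes p) (yes q) (yes r) P⇔ = symmetric (axiom (+-idem _))
    when-⊎ (yes p) (yes q) (no ¬r) P⇔ = symmetric (axiom (+-identityʳ _))
    when-⊎ (yes p) (no ¬q) (yes r) P⇔ = symmetric (+-identityˡ _)
    when-⊎ (yes p) (no ¬q) (no ¬r) P⇔ = ⊥-elim ([ ¬q , ¬r ]′ (to P⇔ p))
    when-⊎ (no ¬p) (yes q) R?      P⇔ = contradiction (from P⇔ (inj₁ q)) ¬p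
    when-⊎ (no ¬p) (no ¬q) (yes r) P⇔ = contradiction (from P⇔ (inj₂ r)) ¬p
    when-⊎ (no ¬p) (no ¬q) (no ¬r) P⇔ = symmetric (+-identityˡ _)

  foldl≈+foldr : ∀ e es → foldl _+_ e es ≈ e + foldr _+_ 𝟎 es
  foldl≈+foldr e []       = symmetric (axiom (+-identityʳ e))
  foldl≈+foldr e (f ∷ es) =
    transitive (foldl≈+foldr (e + f) es) (axiom (+-assoc e f _))

  sum≈foldr : ∀ es → sum es ≈ foldr _+_ 𝟎 es
  sum≈foldr []       = reflexive
  sum≈foldr (e ∷ es) = foldl≈+foldr e es

  -- This turns the list sum of `IsSolution` into a sum over all indices, where a discarded element
  -- leaves a summand `𝟎`.
  foldr-filter-tabulate :
    ∀ {X : Set} {P : Pred X 0ℓ} (P? : Decidable P) (f : X → StExp A) {n} (g : Fin n → X) →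
    foldr _+_ 𝟎 (map f (filter P? (tabulate g))) ≈ ∑ (λ i → when (P? (g i)) (λ _ → f (g i)))
  foldr-filter-tabulate P? f {zero}  g = reflexive
  foldr-filter-tabulate P? f {suc n} g with P? (g zero)
  ... | yes _ = +-cong reflexive (foldr-filter-tabulate P? f (g ∘ suc))
  ... | no  _ = transitive (foldr-filter-tabulate P? f (g ∘ suc))
                           (symmetric (+-identityˡ _))

  -- Solving a 1-chart along the elimination of its loops

  module _ (C : 1-Chart A) where
    open 1-Chart C

    Solution : Pred (V → StExp A) 0ℓ
    Solution = IsSolution Mil C

    τ≡𝟎 : ∀ {w} → w ∉ terminating → τ w ≡ 𝟎
    τ≡𝟎 {w} w∉ with lookup terminating w in eq
    ... | true  = contradiction (lookup⇒[]= w terminating eq) w∉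
    ... | false = refl

    outgoing? : (T : Subset ∣→∣) (w : V) (t : Tr) → Dec (src t ≡ w × t ∈ T)
    outgoing? T w t = (src t ≟ w) ×-dec (t ∈? T)

    -- The sum ranges over all transitions of `C`, so passing to another set `T` changes only the
    -- guards and sums can be compared termwise.
    ∑out : Subset ∣→∣ → V → (V → StExp A) → StExp A
    ∑out T w s = ∑ λ t → when (outgoing? T w t) λ _ → ⌜ label t ⌝ · s (tgt t)

    Equation : Sub C → V → StExp A → Set
    Equation D w E =
      ∀ s → Solution s → s w ≈ E · s w + (τ w + ∑out (transitions D) w s)

    -- `E` is chosen before the solution, so any two solutions share it.
    Reduced : Sub C → Set
    Reduced D = ∀ w → w ∈ vertices D → ∃[ E ] (¬ E ↓ × Equation D w E)

    whole-reduced : Reduced (whole C)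
    whole-reduced w _ = 𝟎 , (λ ()) , λ s sol → begin
      s w
        ≈⟨ sol w ⟩
      τ w + sum (map (summand s) (transitionsFrom w))
        ≈⟨ +-cong reflexive (transitive
             (sum≈foldr (map (summand s) (transitionsFrom w)))
             (foldr-filter-tabulate (λ t → src t ≟ w) (summand s) id)) ⟩
      τ w + ∑ (λ t → when (src t ≟ w) λ _ → summand s t)
        ≈⟨ +-cong reflexive (sum-cong-≋ λ t →
             when-⇔ (src t ≟ w) (outgoing? _ w t) (mk⇔ (_, ∈⊤) proj₁)) ⟩
      τ w + ∑out (transitions (whole C)) w s
        ≈⟨ +-identityˡ _ ⟨
      𝟎 + (τ w + ∑out (transitions (whole C)) w s)
        ≈⟨ +-cong (axiom (·-zeroˡ (s w))) reflexive ⟨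
      𝟎 · s w + (τ w + ∑out (transitions (whole C)) w s) ∎
      where
      summand : (V → StExp A) → Tr → StExp A
      summand s t = ⌜ label t ⌝ · s (tgt t)

    -- Solutions along the body of a loop

    Coefficient : V → V → StExp A → Set
    Coefficient v w T =
      (T ↓ → Star (1-Step C) w v) × (∀ s → Solution s → s w ≈ T · s v)

    module _ {D L : Sub C} {U : Subset ∣→∣} (loopSub : IsLoopSub C D U L) where
      open IsLoopSub loopSub
      open IsLoop isLoop

      private
        v : V
        v = root L

        Gen : Pred Tr 0ℓ
        Gen = Generated C D v U

      generated∈ : ∀ {t} → Gen t → t ∈ transitions D
      generated∈ (entry t∈U)           = proj₁ (entries _ t∈U)
      generated∈ (continue _ _ t∈D _)  = t∈D

      -- The condition `tgt t ≢ v` cuts paths at `v`, so the returns of the loop to its root do not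
      -- count as cycles.
      Next : Rel Tr 0ℓ
      Next t t′ = Gen t × tgt t ≢ v × t′ ∈ transitions D × src t′ ≡ tgt t

      fromEntry : ∀ {t} → Gen t → ∃[ t₀ ] (t₀ ∈ U × Star Next t₀ t)
      fromEntry (entry t∈U)                 = _ , t∈U , ε
      fromEntry (continue g tgt≢v t∈D linked) =
        let t₀ , t₀∈U , path = fromEntry g
        in  t₀ , t₀∈U , path ◅◅ (g , tgt≢v , t∈D , linked) ◅ ε

      Next-source : ∀ {t t′} → TransClosure Next t t′ → Gen t
      Next-source [ g , _ ]     = g
      Next-source ((g , _) ∷ _) = g

      -- A cycle would extend to an infinite path of L that starts at its
      -- root and never returns there, against L2.
      Next-acyclic : ∀ t → ¬ TransClosure Next t t
      Next-acyclic t cycle =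
        let t₀ , t₀∈U , path = fromEntry (Next-source cycle)
            f , f0≡t₀ , next = lasso (*-++ path cycle) cycle
            i , returns      = L2 record
              { step   = f
              ; step∈  = λ i → from (transitions-spec (f i)) (proj₁ (next i))
              ; begins = trans (cong src f0≡t₀) (proj₂ (entries t₀ t₀∈U))
              ; linked = λ i → let _ , _ , _ , eq = next i in sym eq
              }
            _ , tgt≢v , _ = next i
        in  tgt≢v returns

      module _ (reduced : Reduced D) where

        -- Well-founded recursion along `Next`. At `v` the coefficient is `𝟏`; elsewhere it is
        -- assembled from those of the successors, after `RSP*` has solved for the loops already
        -- eliminated at that vertex.
        coefficient : ∀ {t} → Gen t → ∃[ T ] Coefficient v (tgt t) T
        coefficient {t} g = go g (acyclic⇒noetherian Next-acyclic t)
          where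
          go : ∀ {t} → Gen t → Acc (flip Next) t → ∃[ T ] Coefficient v (tgt t) T
          go {t} g (acc rec) with tgt t ≟ v
          ... | yes tgt≡v =
            𝟏 ,
            (λ _ → subst (λ w → Star (1-Step C) w v) (sym tgt≡v) ε) ,
            (λ s _ → subst (λ w → s w ≈ 𝟏 · s v) (sym tgt≡v)
                       (symmetric (axiom (·-identityˡ (s v)))))
          ... | no tgt≢v = E * · F , F-path , equation
            where
            w : V
            w = tgt t

            w∈L : w ∈ vertices L
            w∈L = tgt∈ L (from (transitions-spec t) g)

            E          = proj₁ (reduced w (tgt∈ D (generated∈ g)))
            ¬E↓        = proj₁ (proj₂ (reduced w (tgt∈ D (generated∈ g))))
            E-equation = proj₂ (proj₂ (reduced w (tgt∈ D (generated∈ g))))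

            -- As `w` differs from `v`, every transition of `D` from `w` is generated too, so the
            -- whole sum at `w` is covered.
            ih : ∀ t′ → src t′ ≡ w × t′ ∈ transitions D →
                 ∃[ T ] Coefficient v (tgt t′) T
            ih t′ (src≡w , t′∈D) =
              go (continue g tgt≢v t′∈D src≡w) (rec (g , tgt≢v , t′∈D , src≡w))

            summand : (t′ : Tr) → src t′ ≡ w × t′ ∈ transitions D → StExp A
            summand t′ p = ⌜ label t′ ⌝ · proj₁ (ih t′ p)

            F : StExp A
            F = ∑ λ t′ → when (outgoing? (transitions D) w t′) (summand t′)

            F-path : (E * · F) ↓ → Star (1-Step C) w v
            -- `E *` always terminates, so the information lies in `F`: some summand terminates, its
            -- label is the empty step, and its target has a path of 1-transitions to `v`.
            F-path (·↓ _ F↓) with ∑↓ _ F↓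
            ... | t′ , when-↓ with when↓ (outgoing? (transitions D) w t′) when-↓
            ... | p , ·↓ l↓ T↓ =
              (t′ , proj₁ p , ⌜⌝↓ (label t′) l↓ , refl) ◅ proj₁ (proj₂ (ih t′ p)) T↓

            equation : ∀ s → Solution s → s w ≈ (E * · F) · s v
            equation s sol = begin
              s w
                ≈⟨ rsp ¬E↓ (E-equation s sol) ⟩
              E * · (τ w + ∑out (transitions D) w s)
                -- By `L3` only the root of the loop may terminate. Without this, a summand that is
                -- no multiple of `s v` would remain.
                ≡⟨ cong (λ e → E * · (e + ∑out (transitions D) w s))
                     (τ≡𝟎 (tgt≢v ∘ L3 w w∈L)) ⟩
              E * · (𝟎 + ∑out (transitions D) w s)
                ≈⟨ ·-cong reflexive (+-identityˡ _) ⟩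
              E * · ∑out (transitions D) w s
                ≈⟨ ·-cong reflexive (sum-cong-≋ λ t′ → transitive
                     (when-cong (outgoing? (transitions D) w t′) λ p → transitive
                       (·-cong reflexive (proj₂ (proj₂ (ih t′ p)) s sol))
                       (symmetric (axiom (·-assoc _ _ _))))
                     (symmetric (when-· (outgoing? (transitions D) w t′) (summand t′) (s v)))) ⟩
              E * · ∑ (λ t′ → when (outgoing? (transitions D) w t′) (summand t′) · s v)
                ≈⟨ ·-cong reflexive (∑-· {∣→∣} _ (s v)) ⟨
              E * · (F · s v)
                ≈⟨ axiom (·-assoc _ _ _) ⟨
              (E * · F) · s v ∎

        -- Absorbing the eliminated loop-entry transitions

        module _ {D′ : Sub C} (weaklyGuarded : WeaklyGuarded C)
                 (eliminates : Eliminates C D U D′) where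
          open Eliminates eliminates using (Reachable)
            renaming (vertices-spec to vertices′-spec; transitions-spec to transitions′-spec)

          reachable∈ : ∀ {u w} → u ∈ vertices D → Star (StepWithout C D U) u w → w ∈ vertices D
          reachable∈ u∈D ε                                 = u∈D
          reachable∈ u∈D ((t , t∈D , _ , _ , refl) ◅ path) = reachable∈ (tgt∈ D t∈D) path

          -- Elimination also discards what becomes unreachable. Since `w` stays reachable, the only
          -- transitions it loses are those in `U`.
          outgoing-split : ∀ {w} → Reachable w → ∀ t →
            (src t ≡ w × t ∈ transitions D) ⇔
            ((src t ≡ w × t ∈ U) ⊎ (src t ≡ w × t ∈ transitions D′))
          outgoing-split {w} reachable t = mk⇔ split merge
            where
            split : src t ≡ w × t ∈ transitions D →
                    (src t ≡ w × t ∈ U) ⊎ (src t ≡ w × t ∈ transitions D′)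
            split (src≡w , t∈D) with t ∈? U
            ... | yes t∈U = inj₁ (src≡w , t∈U)
            ... | no  t∉U = inj₂ (src≡w ,
              from (transitions′-spec t) (t∈D , t∉U , subst Reachable (sym src≡w) reachable))

            merge : (src t ≡ w × t ∈ U) ⊎ (src t ≡ w × t ∈ transitions D′) →
                    src t ≡ w × t ∈ transitions D
            merge (inj₁ (src≡w , t∈U))  = src≡w , proj₁ (entries t t∈U)
            merge (inj₂ (src≡w , t∈D′)) = src≡w , proj₁ (to (transitions′-spec t) t∈D′)

          eliminate-reduced : Reduced D′
          eliminate-reduced w w∈D′ = E + F , ¬E+F↓ , equation
            where
            reachable : Reachable w
            reachable = to (vertices′-spec w) w∈D′

            w∈D : w ∈ vertices D
            w∈D = reachable∈ (root∈ D) reachable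

            E          = proj₁ (reduced w w∈D)
            ¬E↓        = proj₁ (proj₂ (reduced w w∈D))
            E-equation = proj₂ (proj₂ (reduced w w∈D))

            root≡ : ∀ {t} → src t ≡ w → t ∈ U → v ≡ w
            root≡ src≡w t∈U = trans (sym (proj₂ (entries _ t∈U))) src≡w

            summand : (t : Tr) → src t ≡ w × t ∈ U → StExp A
            summand t (_ , t∈U) = ⌜ label t ⌝ · proj₁ (coefficient (entry t∈U))

            -- All transitions in `U` leave `v`. For `w` other than `v` each guard fails and `F` is
            -- a sum of `𝟎`s, so both cases are treated uniformly.
            F : StExp A
            F = ∑ λ t → when (outgoing? U w t) (summand t)

            ¬E+F↓ : ¬ (E + F) ↓
            ¬E+F↓ (+↓ˡ E↓) = ¬E↓ E↓
            ¬E+F↓ (+↓ʳ F↓) with ∑↓ _ F↓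
            ... | t , when-↓ with when↓ (outgoing? U w t) when-↓
            ... | (src≡w , t∈U) , ·↓ l↓ T↓ =
              -- The loop-entry 1-transition followed by the 1-path back to `v` is a forbidden
              -- cycle.
              weaklyGuarded v (◅⇒⁺
                (t , proj₂ (entries t t∈U) , ⌜⌝↓ (label t) l↓ , refl)
                (proj₁ (proj₂ (coefficient (entry t∈U))) T↓))

            entry-equation : ∀ s → Solution s → ∀ t (p : src t ≡ w × t ∈ U) →
                             ⌜ label t ⌝ · s (tgt t) ≈ summand t p · s w
            entry-equation s sol t (src≡w , t∈U) = transitive
              (·-cong reflexive (subst (λ u → s (tgt t) ≈ _ · s u) (root≡ src≡w t∈U)
                (proj₂ (proj₂ (coefficient (entry t∈U))) s sol)))
              (symmetric (axiom (·-assoc _ _ _)))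

            equation : Equation D′ w (E + F)
            equation s sol = begin
              s w
                ≈⟨ E-equation s sol ⟩
              E · s w + (τ w + ∑out (transitions D) w s)
                ≈⟨ +-cong reflexive (+-cong reflexive split) ⟩
              E · s w + (τ w + (F · s w + ∑out (transitions D′) w s))
                ≈⟨ +-cong reflexive (x∙yz≈y∙xz (τ w) (F · s w) _) ⟩
              E · s w + (F · s w + (τ w + ∑out (transitions D′) w s))
                ≈⟨ axiom (+-assoc _ _ _) ⟨
              (E · s w + F · s w) + (τ w + ∑out (transitions D′) w s)
                ≈⟨ +-cong (axiom (·-distribʳ E F (s w))) reflexive ⟨
              (E + F) · s w + (τ w + ∑out (transitions D′) w s) ∎
              where
              split : ∑out (transitions D) w s ≈ F · s w + ∑out (transitions D′) w s
              split = begin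
                ∑out (transitions D) w s
                  ≈⟨ sum-cong-≋ (λ t → when-⊎ (outgoing? (transitions D) w t)
                       (outgoing? U w t) (outgoing? (transitions D′) w t)
                       (outgoing-split reachable t)) ⟩
                ∑ (λ t → when (outgoing? U w t) (λ _ → ⌜ label t ⌝ · s (tgt t)) +
                         when (outgoing? (transitions D′) w t) (λ _ → ⌜ label t ⌝ · s (tgt t)))
                  ≈⟨ ∑-distrib-+ {∣→∣} _ _ ⟩
                ∑out U w s + ∑out (transitions D′) w s
                  ≈⟨ +-cong (sum-cong-≋ λ t → transitive
                       (when-cong (outgoing? U w t) (entry-equation s sol t))
                       (symmetric (when-· (outgoing? U w t) (summand t) (s w)))) reflexive ⟩
                ∑ (λ t → when (outgoing? U w t) (summand t) · s w) + ∑out (transitions D′) w s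
                  ≈⟨ +-cong (∑-· {∣→∣} _ (s w)) reflexive ⟨
                F · s w + ∑out (transitions D′) w s ∎

    -- Uniqueness of solutions without infinite paths

    module _ {D : Sub C} (reduced : Reduced D) (finite : ∀ v → ¬ InfinitePath C D v)
             {s₁ s₂ : V → StExp A} (sol₁ : Solution s₁) (sol₂ : Solution s₂) where

      private
        Consecutive : Rel Tr 0ℓ
        Consecutive t t′ = t ∈ transitions D × t′ ∈ transitions D × tgt t ≡ src t′

        Consecutive-acyclic : ∀ t → ¬ TransClosure Consecutive t t
        Consecutive-acyclic t cycle =
          let f , f0≡t , next = lasso cycle cycle
          in  finite (src t) record
                { step   = f
                ; step∈  = proj₁ ∘ next
                ; begins = cong src f0≡t
                ; linked = proj₂ ∘ proj₂ ∘ next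
                }

        -- `RSP*` expresses both values at `w` by the same `E`, `τ w` and labels; only the values at
        -- the targets can differ.
        unique-step : ∀ {w} → w ∈ vertices D →
          (∀ t → src t ≡ w × t ∈ transitions D → s₁ (tgt t) ≈ s₂ (tgt t)) →
          s₁ w ≈ s₂ w
        unique-step {w} w∈D targets =
          let E , ¬E↓ , equation = reduced w w∈D in begin
          s₁ w
            ≈⟨ rsp ¬E↓ (equation s₁ sol₁) ⟩
          E * · (τ w + ∑out (transitions D) w s₁)
            ≈⟨ ·-cong reflexive (+-cong reflexive (sum-cong-≋ λ t →
                 when-cong (outgoing? (transitions D) w t) λ p →
                   ·-cong reflexive (targets t p))) ⟩
          E * · (τ w + ∑out (transitions D) w s₂)
            ≈⟨ rsp ¬E↓ (equation s₂ sol₂) ⟨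
          s₂ w ∎

        unique-target : ∀ {t} → t ∈ transitions D → Acc (flip Consecutive) t →
                        s₁ (tgt t) ≈ s₂ (tgt t)
        unique-target t∈D (acc rec) = unique-step (tgt∈ D t∈D) λ t′ (src≡tgt , t′∈D) →
          unique-target t′∈D (rec (t∈D , t′∈D , sym src≡tgt))

      acyclic-unique : ∀ {w} → w ∈ vertices D → s₁ w ≈ s₂ w
      -- The recursion is on transitions, and `w` need not be the target of one, so the first step
      -- is made separately.
      acyclic-unique w∈D = unique-step w∈D λ t (_ , t∈D) →
        unique-target t∈D (acyclic⇒noetherian Consecutive-acyclic t)

    LLEE-unique : WeaklyGuarded C → LLEE C → ∀ {s₁ s₂} → Solution s₁ → Solution s₂ →
                  s₁ start ≈ s₂ start
    LLEE-unique weaklyGuarded llee {s₁} {s₂} sol₁ sol₂ =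
      let reduced , root≡start = invariant (fromℕ k)
      in  subst (λ w → s₁ w ≈ s₂ w) root≡start
            (acyclic-unique reduced final sol₁ sol₂ (root∈ (charts (fromℕ k))))
      where
      open LLEE llee

      -- The root is tracked because uniqueness is obtained at the root of the final 1-chart but is
      -- wanted at `start`.
      invariant : ∀ i → Reduced (charts i) × root (charts i) ≡ start
      invariant = <-weakInduction _
        (subst (λ D → Reduced D × root D ≡ start) (sym initial) (whole-reduced , refl))
        λ i (reduced , root≡start) →
          eliminate-reduced (loopSub i) reduced weaklyGuarded (eliminates i) ,
          trans (Eliminates.root-spec (eliminates i)) root≡start

proposition5p7 : (A : Set) (S : ELSystem A) → ACI ⊆ S → S ≾ Mil →
    (e₁ e₂ : StExp A) (P : CoinductiveProof S e₁ e₂) → LLEEWitnessed P →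
    Mil ⊢ e₁ ≐ e₂
-- By `S ≾ Mil`, both components of `L` are solutions provable in `Mil`, so their values at `start`
-- can be compared there.
proposition5p7 A S _ S≾Mil e₁ e₂ P llee
  rewrite CoinductiveProof.start₁ P | CoinductiveProof.start₂ P =
  LLEE-unique chart weaklyGuarded llee
    (λ v → S≾Mil _ (solution₁ v)) (λ v → S≾Mil _ (solution₂ v))
  where open CoinductiveProof P using (chart; weaklyGuarded; solution₁; solution₂)
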